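{- Let $R\subseteq\mathbb{C}$ be a subset such that $M:=\inf\{|x|: x\in R\setminus\{0\}\}>0$. Let $\mathcal{F}=(c_{i,j})$ be a frieze pattern over $R\setminus\{0\}$ of height $n\in\mathbb{N}$. Then every entry $c_{i,i+2}$ ($i\in\mathbb{Z}$) of its quiddity cycle satisfies $$|c_{i,i+2}|\le\frac{(n-1)+2M}{M^2}.$$
   Context: A frieze pattern of height $n$ over $S\subseteq\mathbb{C}$ is a family $(c_{i,j})_{i\in\mathbb{Z},\ i\le j\le i+n+3}$ of complex numbers such that: - $c_{i,i}=c_{i,i+n+3}=0$ and $c_{i,i+1}=c_{i,i+n+2}=1$; - $c_{i,j}\in S$ for $i+2\le j\le i+n+1$; - every adjacent $2\times2$ determinant $c_{i,j}c_{i+1,j+1}-c_{i,j+1}c_{i+1,j}$ (all entries defined) equals $1$. "Over $R\setminus\{0\}$" means all entries $c_{i,j}$ with $i+2\le j\le i+n+1$ are nonzero elements of $R$. The quiddity cycle of the pattern consists of the entries $c_{i,i+2}$ of its first nontrivial diagonal. -}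

module Defs where

open import Data.Bool.Base using (if_then_else_)
open import Data.Integer.Base as ℤ using (ℤ; +_)
import Data.Integer.Properties as ℤ
open import Data.Nat.Base as ℕ using (ℕ; zero; suc)
import Data.Nat.Coprimality as Coprime
import Data.Nat.Properties as ℕ
open import Data.Product.Base using (∃-syntax; _×_; _,_)
open import Data.Rational.Base as ℚ using (ℚ; 0ℚ; 1ℚ; ½; *≤*)
import Data.Rational.Properties as ℚ
open import Data.Rational.Solver using (module +-*-Solver)
open import Data.Sum.Base as Sum using (_⊎_; inj₁; inj₂)
open import Level using (Level; 0ℓ)
open import Relation.Binary.PropositionalEquality
  using (_≡_; refl; sym; trans; cong; cong₂; subst; subst₂)
open import Relation.Nullary using (¬_; Dec; yes; no; does; contradiction)
open import Relation.Unary using (Pred)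

private
  variable
    ℓ : Level

------------------------------------------------------------------------
-- Rational arithmetic

module ℚ-Lemmas where

  open import Data.Rational.Base using (_≤_; _<_; _+_; _*_; _-_; -_; ∣_∣)
  open ℚ.≤-Reasoning
  open +-*-Solver using (solve; _:=_; _:+_; _:*_; :-_; _:-_; con)

  half : ∀ {ε} → 0ℚ < ε → 0ℚ < ½ * ε
  half {ε} 0<ε = subst (_< ½ * ε) (ℚ.*-zeroʳ ½) (ℚ.*-monoʳ-<-pos ½ 0<ε)

  half+half : ∀ ε → ½ * ε + ½ * ε ≡ ε
  half+half ε = trans (sym (ℚ.*-distribʳ-+ ε ½ ½)) (ℚ.*-identityˡ ε)

  *-pos : ∀ {p q} → 0ℚ < p → 0ℚ < q → 0ℚ < p * q
  *-pos {p} {q} 0<p 0<q =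
    ℚ.positive⁻¹ _ {{ℚ.pos*pos⇒pos p {{ℚ.positive 0<p}} q {{ℚ.positive 0<q}}}}

  +-pos : ∀ {p q} → 0ℚ < p → 0ℚ < q → 0ℚ < p + q
  +-pos = ℚ.+-mono-<

  *-mono-≤ : ∀ {p q r s} → 0ℚ ≤ p → p ≤ q → 0ℚ ≤ r → r ≤ s → p * r ≤ q * s
  *-mono-≤ {p} {q} {r} {s} 0≤p p≤q 0≤r r≤s = begin
    p * r  ≤⟨ ℚ.*-monoˡ-≤-nonNeg p {{ℚ.nonNegative 0≤p}} r≤s ⟩
    p * s  ≤⟨ ℚ.*-monoʳ-≤-nonNeg s {{ℚ.nonNegative (ℚ.≤-trans 0≤r r≤s)}} p≤q ⟩
    q * s  ∎

  square-cancel-< : ∀ {p q} → 0ℚ ≤ q → p * p < q * q → p < q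
  square-cancel-< {p} {q} 0≤q pp<qq with p ℚ.<? q
  ... | yes p<q = p<q
  ... | no  p≮q = contradiction (ℚ.<-≤-trans pp<qq (*-mono-≤ 0≤q q≤p 0≤q q≤p)) (ℚ.<-irrefl refl)
    where q≤p = ℚ.≮⇒≥ p≮q

  p≤∣p∣ : ∀ p → p ≤ ∣ p ∣
  p≤∣p∣ p with ℚ.≤-total 0ℚ p
  ... | inj₁ 0≤p = ℚ.≤-reflexive (sym (ℚ.0≤p⇒∣p∣≡p 0≤p))
  ... | inj₂ p≤0 = ℚ.≤-trans p≤0 (ℚ.0≤∣p∣ p)

  ∣p-q∣≡∣q-p∣ : ∀ p q → ∣ p - q ∣ ≡ ∣ q - p ∣
  ∣p-q∣≡∣q-p∣ p q = trans (cong ∣_∣ (solve 2 (λ p q → p :- q := :- (q :- p)) refl p q))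
                          (ℚ.∣-p∣≡∣p∣ (q - p))

  ∣-∣⇒≤ : ∀ {p q ε} → ∣ p - q ∣ ≤ ε → p ≤ q + ε
  ∣-∣⇒≤ {p} {q} {ε} h = begin
    p            ≡⟨ solve 2 (λ p q → p := q :+ (p :- q)) refl p q ⟩
    q + (p - q)  ≤⟨ ℚ.+-monoʳ-≤ q (ℚ.≤-trans (p≤∣p∣ (p - q)) h) ⟩
    q + ε        ∎

  ≤⇒∣-∣ : ∀ {p q ε} → p ≤ q + ε → q ≤ p + ε → ∣ p - q ∣ ≤ ε
  ≤⇒∣-∣ {p} {q} {ε} h k with ℚ.∣p∣≡p∨∣p∣≡-p (p - q)
  ... | inj₁ e = begin
    ∣ p - q ∣    ≡⟨ e ⟩
    p - q        ≤⟨ ℚ.+-monoˡ-≤ (- q) h ⟩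
    q + ε - q    ≡⟨ solve 2 (λ q ε → q :+ ε :- q := ε) refl q ε ⟩
    ε            ∎
  ... | inj₂ e = begin
    ∣ p - q ∣    ≡⟨ e ⟩
    - (p - q)    ≡⟨ solve 2 (λ p q → :- (p :- q) := q :- p) refl p q ⟩
    q - p        ≤⟨ ℚ.+-monoˡ-≤ (- p) k ⟩
    p + ε - p    ≡⟨ solve 2 (λ p ε → p :+ ε :- p := ε) refl p ε ⟩
    ε            ∎

  +-close : ∀ {a b c d} ε → ∣ a - c ∣ ≤ ½ * ε → ∣ b - d ∣ ≤ ½ * ε →
            ∣ a + b - (c + d) ∣ ≤ ε
  +-close {a} {b} {c} {d} ε h k = begin
    ∣ a + b - (c + d) ∣      ≡⟨ cong ∣_∣ (solve 4 (λ a b c d →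
                                a :+ b :- (c :+ d) := (a :- c) :+ (b :- d)) refl a b c d) ⟩
    ∣ (a - c) + (b - d) ∣    ≤⟨ ℚ.∣p+q∣≤∣p∣+∣q∣ (a - c) (b - d) ⟩
    ∣ a - c ∣ + ∣ b - d ∣    ≤⟨ ℚ.+-mono-≤ h k ⟩
    ½ * ε + ½ * ε            ≡⟨ half+half ε ⟩
    ε                        ∎

  *-close : ∀ {a b c d A D δ} → ∣ a ∣ ≤ A → ∣ d ∣ ≤ D →
            ∣ a - c ∣ ≤ δ → ∣ b - d ∣ ≤ δ → ∣ a * b - c * d ∣ ≤ (A + D) * δ
  *-close {a} {b} {c} {d} {A} {D} {δ} a≤A d≤D h k = begin
    ∣ a * b - c * d ∣                      ≡⟨ cong ∣_∣ (solve 4 (λ a b c d →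
                                              a :* b :- c :* d :=
                                              a :* (b :- d) :+ d :* (a :- c)) refl a b c d) ⟩
    ∣ a * (b - d) + d * (a - c) ∣          ≤⟨ ℚ.∣p+q∣≤∣p∣+∣q∣ (a * (b - d)) (d * (a - c)) ⟩
    ∣ a * (b - d) ∣ + ∣ d * (a - c) ∣      ≡⟨ cong₂ _+_ (ℚ.∣p*q∣≡∣p∣*∣q∣ a (b - d))
                                                        (ℚ.∣p*q∣≡∣p∣*∣q∣ d (a - c)) ⟩
    ∣ a ∣ * ∣ b - d ∣ + ∣ d ∣ * ∣ a - c ∣  ≤⟨ ℚ.+-mono-≤
                                               (*-mono-≤ (ℚ.0≤∣p∣ a) a≤A (ℚ.0≤∣p∣ (b - d)) k)
                                               (*-mono-≤ (ℚ.0≤∣p∣ d) d≤D (ℚ.0≤∣p∣ (a - c)) h) ⟩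
    A * δ + D * δ                          ≡⟨ ℚ.*-distribʳ-+ δ A D ⟨
    (A + D) * δ                            ∎

  divide-pos : ∀ {p ε} → 0ℚ < p → 0ℚ < ε → ∃[ δ ] 0ℚ < δ × p * δ ≡ ε
  divide-pos {p} {ε} 0<p 0<ε = p⁻¹ * ε , *-pos 0<p⁻¹ 0<ε , (begin-equality
    p * (p⁻¹ * ε)  ≡⟨ ℚ.*-assoc p p⁻¹ ε ⟨
    p * p⁻¹ * ε    ≡⟨ cong (_* ε) (ℚ.*-inverseʳ p {{nz}}) ⟩
    1ℚ * ε         ≡⟨ ℚ.*-identityˡ ε ⟩
    ε              ∎)
    where
    nz     = ℚ.>-nonZero 0<p
    p⁻¹    = ℚ.1/_ p {{nz}}
    0<p⁻¹  = ℚ.positive⁻¹ p⁻¹ {{ℚ.1/pos⇒pos p {{ℚ.positive 0<p}}}}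

  -- The convention recip 0 = 0 makes this total.
  opaque
    recip : ℚ → ℚ
    recip p with p ℚ.≟ 0ℚ
    ... | yes _   = 0ℚ
    ... | no  p≢0 = ℚ.1/_ p {{ℚ.≢-nonZero p≢0}}

    *-recip : ∀ {p} → 0ℚ < p → p * recip p ≡ 1ℚ
    *-recip {p} 0<p with p ℚ.≟ 0ℚ
    ... | yes p≡0 = contradiction (sym p≡0) (ℚ.<⇒≢ 0<p)
    ... | no  p≢0 = ℚ.*-inverseʳ p {{ℚ.≢-nonZero p≢0}}

  recip-close : ∀ {a b δ ε} → 0ℚ < δ → δ ≤ a → δ ≤ b →
                ∣ a - b ∣ ≤ δ * δ * ε → ∣ recip a - recip b ∣ ≤ ε
  recip-close {a} {b} {δ} {ε} 0<δ δ≤a δ≤b h =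
    ℚ.*-cancelˡ-≤-pos (δ * δ) {{ℚ.positive (*-pos 0<δ 0<δ)}} (begin
      δ * δ * ∣ a′ - b′ ∣    ≤⟨ ℚ.*-monoʳ-≤-nonNeg ∣ a′ - b′ ∣ {{ℚ.∣-∣-nonNeg (a′ - b′)}}
                                  (*-mono-≤ 0≤δ δ≤a 0≤δ δ≤b) ⟩
      a * b * ∣ a′ - b′ ∣    ≡⟨ cong (_* ∣ a′ - b′ ∣) (ℚ.0≤p⇒∣p∣≡p 0≤ab) ⟨
      ∣ a * b ∣ * ∣ a′ - b′ ∣ ≡⟨ ℚ.∣p*q∣≡∣p∣*∣q∣ (a * b) (a′ - b′) ⟨
      ∣ a * b * (a′ - b′) ∣  ≡⟨ cong ∣_∣ (solve 4 (λ a b a′ b′ →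
                                a :* b :* (a′ :- b′) :=
                                (a :* a′) :* b :- (b :* b′) :* a) refl a b a′ b′) ⟩
      ∣ a * a′ * b - b * b′ * a ∣ ≡⟨ cong₂ (λ u v → ∣ u * b - v * a ∣) (*-recip 0<a) (*-recip 0<b) ⟩
      ∣ 1ℚ * b - 1ℚ * a ∣    ≡⟨ cong₂ (λ u v → ∣ u - v ∣) (ℚ.*-identityˡ b) (ℚ.*-identityˡ a) ⟩
      ∣ b - a ∣              ≡⟨ ∣p-q∣≡∣q-p∣ b a ⟩
      ∣ a - b ∣              ≤⟨ h ⟩
      δ * δ * ε              ∎)
    where
    a′   = recip a
    b′   = recip b
    0≤δ  = ℚ.<⇒≤ 0<δ
    0<a  = ℚ.<-≤-trans 0<δ δ≤a
    0<b  = ℚ.<-≤-trans 0<δ δ≤b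
    0≤ab = ℚ.<⇒≤ (*-pos 0<a 0<b)

  opaque
    fromℕ : ℕ → ℚ
    fromℕ n = + n ℚ./ 1

    fromℕ-suc : ∀ n → fromℕ (suc n) ≡ fromℕ n + 1ℚ
    fromℕ-suc n = sym (trans (cong (_+ 1ℚ) (ℚ.normalize-coprime (Coprime.sym (Coprime.1-coprimeTo n))))
                             (cong (ℚ._/ 1) (trans (cong₂ ℤ._+_ (ℤ.*-identityʳ (+ n)) refl)
                                                   (cong +_ (ℕ.+-comm n 1)))))

    fromℕ-0 : fromℕ 0 ≡ 0ℚ
    fromℕ-0 = refl

    fromℕ-1 : fromℕ 1 ≡ 1ℚ
    fromℕ-1 = refl

    0≤fromℕ : ∀ n → 0ℚ ≤ fromℕ n
    0≤fromℕ n = ℚ.nonNegative⁻¹ _ {{ℚ.normalize-nonNeg n 1}}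

    0<fromℕ-suc : ∀ n → 0ℚ < fromℕ (suc n)
    0<fromℕ-suc n = ℚ.positive⁻¹ _ {{ℚ.normalize-pos (suc n) 1}}

    ≤fromℕ : ∀ p → p ≤ fromℕ ℤ.∣ ℚ.↥ p ∣
    ≤fromℕ p@(ℚ.mkℚ i d _) =
      subst (p ≤_) (sym (ℚ.normalize-coprime (Coprime.sym (Coprime.1-coprimeTo ℤ.∣ i ∣))))
        (*≤* (lemma i))
      where
      lemma : ∀ i → i ℤ.* + 1 ℤ.≤ + ℤ.∣ i ∣ ℤ.* + suc d
      lemma (+ m) = subst₂ ℤ._≤_ (ℤ.pos-* m 1) (ℤ.pos-* m (suc d))
                      (ℤ.+≤+ (ℕ.*-monoʳ-≤ m (ℕ.s≤s ℕ.z≤n)))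
      lemma ℤ.-[1+ m ] = ℤ.-≤+

  fromℕ-mono : ∀ {m n} → m ℕ.≤ n → fromℕ m ≤ fromℕ n
  fromℕ-mono {n = n} ℕ.z≤n = subst (_≤ fromℕ n) (sym fromℕ-0) (0≤fromℕ n)
  fromℕ-mono {suc m} {suc n} (ℕ.s≤s m≤n) =
    subst₂ _≤_ (sym (fromℕ-suc m)) (sym (fromℕ-suc n)) (ℚ.+-monoˡ-≤ 1ℚ (fromℕ-mono m≤n))

  fromℕ-suc-* : ∀ m u → fromℕ (suc m) * u ≡ fromℕ m * u + u
  fromℕ-suc-* m u = begin-equality
    fromℕ (suc m) * u     ≡⟨ cong (_* u) (fromℕ-suc m) ⟩
    (fromℕ m + 1ℚ) * u    ≡⟨ solve 2 (λ x u → (x :+ con 1ℚ) :* u := x :* u :+ u) refl (fromℕ m) u ⟩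
    fromℕ m * u + u       ∎

  fromℕ-+ : ∀ m n → fromℕ (m ℕ.+ n) ≡ fromℕ m + fromℕ n
  fromℕ-+ zero    n = sym (trans (cong (_+ fromℕ n) fromℕ-0) (ℚ.+-identityˡ (fromℕ n)))
  fromℕ-+ (suc m) n = begin-equality
    fromℕ (suc (m ℕ.+ n))        ≡⟨ fromℕ-suc (m ℕ.+ n) ⟩
    fromℕ (m ℕ.+ n) + 1ℚ         ≡⟨ cong (_+ 1ℚ) (fromℕ-+ m n) ⟩
    fromℕ m + fromℕ n + 1ℚ       ≡⟨ solve 2 (λ x y → x :+ y :+ con 1ℚ := x :+ con 1ℚ :+ y) refl
                                      (fromℕ m) (fromℕ n) ⟩
    fromℕ m + 1ℚ + fromℕ n       ≡⟨ cong (_+ fromℕ n) (fromℕ-suc m) ⟨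
    fromℕ (suc m) + fromℕ n      ∎

  fromℕ-* : ∀ m n → fromℕ (m ℕ.* n) ≡ fromℕ m * fromℕ n
  fromℕ-* zero    n = trans fromℕ-0 (sym (trans (cong (_* fromℕ n) fromℕ-0) (ℚ.*-zeroˡ (fromℕ n))))
  fromℕ-* (suc m) n = begin-equality
    fromℕ (n ℕ.+ m ℕ.* n)           ≡⟨ fromℕ-+ n (m ℕ.* n) ⟩
    fromℕ n + fromℕ (m ℕ.* n)       ≡⟨ cong (λ x → fromℕ n + x) (fromℕ-* m n) ⟩
    fromℕ n + fromℕ m * fromℕ n     ≡⟨ ℚ.+-comm (fromℕ n) _ ⟩
    fromℕ m * fromℕ n + fromℕ n     ≡⟨ fromℕ-suc-* m (fromℕ n) ⟨
    fromℕ (suc m) * fromℕ n         ∎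

  unit : ℕ → ℚ
  unit n = recip (fromℕ (suc n))

  fromℕ-unit : ∀ n → fromℕ (suc n) * unit n ≡ 1ℚ
  fromℕ-unit n = *-recip (0<fromℕ-suc n)

  0<unit : ∀ n → 0ℚ < unit n
  0<unit n = ℚ.*-cancelˡ-<-nonNeg k {{ℚ.nonNegative (0≤fromℕ (suc n))}}
    (subst₂ _<_ (sym (ℚ.*-zeroʳ k)) (sym (fromℕ-unit n)) (ℚ.positive⁻¹ 1ℚ))
    where k = fromℕ (suc n)

  unit-small : ∀ {ε} → 0ℚ < ε → ∃[ N ] (∀ n → N ℕ.≤ n → unit n ≤ ε)
  unit-small {ε} 0<ε = N , λ n N≤n →
    let k = fromℕ (suc n) in
    ℚ.*-cancelˡ-≤-pos k {{ℚ.positive (0<fromℕ-suc n)}} (begin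
      k * unit n     ≡⟨ fromℕ-unit n ⟩
      1ℚ             ≡⟨ ε*δ≡1 ⟨
      ε * δ          ≡⟨ ℚ.*-comm ε δ ⟩
      δ * ε          ≤⟨ ℚ.*-monoʳ-≤-nonNeg ε {{ℚ.nonNegative (ℚ.<⇒≤ 0<ε)}}
                          (ℚ.≤-trans (≤fromℕ δ) (fromℕ-mono (ℕ.m≤n⇒m≤1+n N≤n))) ⟩
      k * ε          ∎)
    where
    δ     = recip ε
    ε*δ≡1 = *-recip 0<ε
    N     = ℤ.∣ ℚ.↥ δ ∣

  -- The largest m ≤ b with P m, or 0 if there is none.
  greatest : ∀ {P : ℕ → Set} → (∀ m → Dec (P m)) → ℕ → ℕ
  greatest P? zero    = 0
  greatest P? (suc b) = if does (P? (suc b)) then suc b else greatest P? b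

  greatest-holds : ∀ {P : ℕ → Set} (P? : ∀ m → Dec (P m)) b →
                   greatest P? b ≡ 0 ⊎ P (greatest P? b)
  greatest-holds P? zero = inj₁ refl
  greatest-holds P? (suc b) with P? (suc b)
  ... | yes h = inj₂ h
  ... | no  _ = greatest-holds P? b

  suc-greatest-fails : ∀ {P : ℕ → Set} (P? : ∀ m → Dec (P m)) b →
                       ¬ P (suc b) → ¬ P (suc (greatest P? b))
  suc-greatest-fails P? zero h = h
  suc-greatest-fails P? (suc b) h with P? (suc b)
  ... | yes _ = h
  ... | no ¬p = suc-greatest-fails P? b ¬p

  SquareBelow : ℕ → ℚ → ℕ → Set
  SquareBelow n p m = (fromℕ m * unit n) * (fromℕ m * unit n) ≤ p

  squareBelow? : ∀ n p m → Dec (SquareBelow n p m)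
  squareBelow? n p m = (fromℕ m * unit n) * (fromℕ m * unit n) ℚ.≤? p

  numerator-sqrt : ℕ → ℚ → ℕ
  numerator-sqrt n p = greatest (squareBelow? n p) (suc n ℕ.* suc ℤ.∣ ℚ.↥ p ∣)

  opaque

    -- sqrt n p is √p rounded down to a multiple of 1 / (n + 1), and 0 for p < 0.
    sqrt : ℕ → ℚ → ℚ
    sqrt n p = fromℕ (numerator-sqrt n p) * unit n

    sqrt-nonNeg : ∀ n p → 0ℚ ≤ sqrt n p
    sqrt-nonNeg n p = subst (_≤ sqrt n p) (ℚ.*-zeroˡ (unit n))
      (ℚ.*-monoʳ-≤-nonNeg (unit n) {{ℚ.nonNegative (ℚ.<⇒≤ (0<unit n))}} (0≤fromℕ (numerator-sqrt n p)))

    sqrt-lower : ∀ n p → sqrt n p ≡ 0ℚ ⊎ sqrt n p * sqrt n p ≤ p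
    sqrt-lower n p = Sum.map₁ zero-root
      (greatest-holds (squareBelow? n p) (suc n ℕ.* suc ℤ.∣ ℚ.↥ p ∣))
      where
      zero-root : numerator-sqrt n p ≡ 0 → sqrt n p ≡ 0ℚ
      zero-root r≡0 = trans (cong (_* unit n) (trans (cong fromℕ r≡0) fromℕ-0)) (ℚ.*-zeroˡ (unit n))

    sqrt-upper : ∀ n p → p < (sqrt n p + unit n) * (sqrt n p + unit n)
    sqrt-upper n p = subst (λ x → p < x * x) (fromℕ-suc-* (numerator-sqrt n p) u)
      (ℚ.≰⇒> (suc-greatest-fails {SquareBelow n p} (squareBelow? n p) b
        λ t²≤p → ℚ.<-irrefl refl (ℚ.<-≤-trans p<t² t²≤p)))
      where
      u : ℚ
      u = unit n
      a : ℕ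
      a = ℤ.∣ ℚ.↥ p ∣
      b : ℕ
      b = suc n ℕ.* suc a
      t : ℚ
      t = fromℕ (suc b) * u
      A : ℚ
      A = fromℕ (suc a)
      A≤t : A ≤ t
      A≤t = begin
        A                             ≡⟨ ℚ.*-identityˡ A ⟨
        1ℚ * A                        ≡⟨ cong (_* A) (fromℕ-unit n) ⟨
        fromℕ (suc n) * u * A         ≡⟨ solve 3 (λ x y z → x :* y :* z := x :* z :* y) refl
                                           (fromℕ (suc n)) u A ⟩
        fromℕ (suc n) * A * u         ≡⟨ cong (_* u) (fromℕ-* (suc n) (suc a)) ⟨
        fromℕ b * u                   ≤⟨ ℚ.*-monoʳ-≤-nonNeg u {{ℚ.nonNegative (ℚ.<⇒≤ (0<unit n))}}
                                           (fromℕ-mono (ℕ.n≤1+n b)) ⟩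
        t                             ∎
      0≤A : 0ℚ ≤ A
      0≤A = 0≤fromℕ (suc a)
      p<t² : p < t * t
      p<t² = begin-strict
        p              ≤⟨ ≤fromℕ p ⟩
        fromℕ a        ≡⟨ ℚ.+-identityʳ (fromℕ a) ⟨
        fromℕ a + 0ℚ   <⟨ ℚ.+-monoʳ-< (fromℕ a) (ℚ.positive⁻¹ 1ℚ) ⟩
        fromℕ a + 1ℚ   ≡⟨ fromℕ-suc a ⟨
        A              ≡⟨ ℚ.*-identityʳ A ⟨
        A * 1ℚ         ≡⟨ cong (A *_) fromℕ-1 ⟨
        A * fromℕ 1    ≤⟨ ℚ.*-monoˡ-≤-nonNeg A {{ℚ.nonNegative 0≤A}} (fromℕ-mono (ℕ.s≤s ℕ.z≤n)) ⟩
        A * A          ≤⟨ *-mono-≤ 0≤A A≤t 0≤A A≤t ⟩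
        t * t          ∎

  sqrt-mono : ∀ m n p q {ε} → 0ℚ < ε → unit n ≤ ½ * ε →
              p ≤ q + (½ * ε) * (½ * ε) → sqrt m p ≤ sqrt n q + ε
  sqrt-mono m n p q {ε} 0<ε u≤δ p≤q+δ² with sqrt-lower m p
  ... | inj₁ s≡0 = subst (_≤ sqrt n q + ε) (sym s≡0)
                     (ℚ.+-mono-≤ (sqrt-nonNeg n q) (ℚ.<⇒≤ 0<ε))
  ... | inj₂ s²≤p = ℚ.<⇒≤ (square-cancel-< (ℚ.+-mono-≤ (sqrt-nonNeg n q) (ℚ.<⇒≤ 0<ε)) (begin-strict
      sqrt m p * sqrt m p                ≤⟨ s²≤p ⟩
      p                                  ≤⟨ p≤q+δ² ⟩
      q + δ * δ                          <⟨ ℚ.+-monoˡ-< (δ * δ) (sqrt-upper n q) ⟩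
      (s + unit n) * (s + unit n) + δ * δ ≤⟨ ℚ.+-monoˡ-≤ (δ * δ) (*-mono-≤ 0≤s+u s+u≤s+δ 0≤s+u s+u≤s+δ) ⟩
      (s + δ) * (s + δ) + δ * δ          ≡⟨ ℚ.+-identityʳ _ ⟨
      (s + δ) * (s + δ) + δ * δ + 0ℚ     ≤⟨ ℚ.+-monoʳ-≤ ((s + δ) * (s + δ) + δ * δ) 0≤cross ⟩
      (s + δ) * (s + δ) + δ * δ + ((s + δ) * δ + (s + δ) * δ)
                                         ≡⟨ solve 2 (λ s δ →
                                              (s :+ δ) :* (s :+ δ) :+ δ :* δ :+ ((s :+ δ) :* δ :+ (s :+ δ) :* δ)
                                              := (s :+ (δ :+ δ)) :* (s :+ (δ :+ δ))) refl s δ ⟩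
      (s + (δ + δ)) * (s + (δ + δ))      ≡⟨ cong (λ x → (s + x) * (s + x)) (half+half ε) ⟩
      (s + ε) * (s + ε)                  ∎))
    where
    s = sqrt n q
    δ = ½ * ε
    0≤s = sqrt-nonNeg n q
    0≤δ = ℚ.<⇒≤ (half 0<ε)
    0≤s+u = ℚ.+-mono-≤ 0≤s (ℚ.<⇒≤ (0<unit n))
    s+u≤s+δ = ℚ.+-monoʳ-≤ s u≤δ
    0≤s+δ = ℚ.+-mono-≤ 0≤s 0≤δ
    0≤[s+δ]δ : 0ℚ ≤ (s + δ) * δ
    0≤[s+δ]δ = *-mono-≤ ℚ.≤-refl 0≤s+δ ℚ.≤-refl 0≤δ
    0≤cross = ℚ.+-mono-≤ 0≤[s+δ]δ 0≤[s+δ]δ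

open ℚ-Lemmas using (recip; sqrt)

------------------------------------------------------------------------
-- Real numbers, as Cauchy sequences of rationals

Cauchy : (ℕ → ℚ) → Set
Cauchy s = ∀ {ε} → 0ℚ ℚ.< ε →
           ∃[ N ] (∀ m n → N ℕ.≤ m → N ℕ.≤ n → ℚ.∣ s m ℚ.- s n ∣ ℚ.≤ ε)

record ℝ : Set where
  constructor mkℝ
  field
    seq    : ℕ → ℚ
    cauchy : Cauchy seq

open ℝ public

Eventually : Pred ℕ 0ℓ → Set
Eventually P = ∃[ N ] (∀ n → N ℕ.≤ n → P n)

infix 4 _≈_ _≤_ _<_

record _≈_ (x y : ℝ) : Set where
  constructor mk≈
  field
    close : ∀ ε → 0ℚ ℚ.< ε → Eventually λ n → ℚ.∣ seq x n ℚ.- seq y n ∣ ℚ.≤ ε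

record _≤_ (x y : ℝ) : Set where
  constructor mk≤
  field
    below : ∀ ε → 0ℚ ℚ.< ε → Eventually λ n → seq x n ℚ.≤ seq y n ℚ.+ ε

record _<_ (x y : ℝ) : Set where
  constructor mk<
  field
    gap      : ℚ
    0<gap    : 0ℚ ℚ.< gap
    gapBelow : Eventually λ n → seq x n ℚ.+ gap ℚ.≤ seq y n

module _ where

  open ℚ-Lemmas

  opaque

    +-cauchy : ∀ {s t} → Cauchy s → Cauchy t → Cauchy λ n → s n ℚ.+ t n
    +-cauchy {s} {t} cs ct {ε} 0<ε with cs (half 0<ε) | ct (half 0<ε)
    ... | M , hs | N , ht = M ℕ.⊔ N , λ m n p q →
      +-close {s m} {t m} {s n} {t n} ε (hs m n (ℕ.m⊔n≤o⇒m≤o M N p) (ℕ.m⊔n≤o⇒m≤o M N q))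
                (ht m n (ℕ.m⊔n≤o⇒n≤o M N p) (ℕ.m⊔n≤o⇒n≤o M N q))

    neg-cauchy : ∀ {s} → Cauchy s → Cauchy λ n → ℚ.- s n
    neg-cauchy {s} cs 0<ε with cs 0<ε
    ... | N , h = N , λ m n p q → subst (ℚ._≤ _) (sym (eq (s m) (s n))) (h m n p q)
      where
      eq : ∀ a b → ℚ.∣ ℚ.- a ℚ.- ℚ.- b ∣ ≡ ℚ.∣ a ℚ.- b ∣
      eq a b = trans (cong ℚ.∣_∣ (sym (ℚ.neg-distrib-+ a (ℚ.- b)))) (ℚ.∣-p∣≡∣p∣ (a ℚ.- b))

    cauchy-bounded : ∀ {s} → Cauchy s →
                     ∃[ B ] 0ℚ ℚ.< B × Eventually λ n → ℚ.∣ s n ∣ ℚ.≤ B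
    cauchy-bounded {s} cs with cs (ℚ.positive⁻¹ 1ℚ)
    ... | N , h = ℚ.∣ s N ∣ ℚ.+ 1ℚ
                , ℚ.+-mono-≤-< (ℚ.0≤∣p∣ (s N)) (ℚ.positive⁻¹ 1ℚ)
                , N , λ n N≤n → begin
        ℚ.∣ s n ∣                            ≡⟨ cong ℚ.∣_∣ (solve 2 (λ a b → a := b :+ (a :- b)) refl (s n) (s N)) ⟩
        ℚ.∣ s N ℚ.+ (s n ℚ.- s N) ∣          ≤⟨ ℚ.∣p+q∣≤∣p∣+∣q∣ (s N) (s n ℚ.- s N) ⟩
        ℚ.∣ s N ∣ ℚ.+ ℚ.∣ s n ℚ.- s N ∣      ≤⟨ ℚ.+-monoʳ-≤ ℚ.∣ s N ∣ (h n N N≤n ℕ.≤-refl) ⟩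
        ℚ.∣ s N ∣ ℚ.+ 1ℚ                     ∎
      where
      open ℚ.≤-Reasoning
      open +-*-Solver using (solve; _:=_; _:+_; _:-_)

    *-cauchy : ∀ {s t} → Cauchy s → Cauchy t → Cauchy λ n → s n ℚ.* t n
    *-cauchy {s} {t} cs ct {ε} 0<ε =
      let A , 0<A , K , hA = cauchy-bounded cs
          D , 0<D , L , hD = cauchy-bounded ct
          δ , 0<δ , [A+D]δ≡ε = divide-pos {A ℚ.+ D} (+-pos {A} {D} 0<A 0<D) 0<ε
          M , hs = cs 0<δ
          N , ht = ct 0<δ
      in (K ℕ.⊔ L) ℕ.⊔ (M ℕ.⊔ N) , λ m n p q →
        let p₁ = ℕ.m⊔n≤o⇒m≤o (K ℕ.⊔ L) (M ℕ.⊔ N) p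
            p₂ = ℕ.m⊔n≤o⇒n≤o (K ℕ.⊔ L) (M ℕ.⊔ N) p
            q₁ = ℕ.m⊔n≤o⇒m≤o (K ℕ.⊔ L) (M ℕ.⊔ N) q
            q₂ = ℕ.m⊔n≤o⇒n≤o (K ℕ.⊔ L) (M ℕ.⊔ N) q
        in subst (ℚ.∣ s m ℚ.* t m ℚ.- s n ℚ.* t n ∣ ℚ.≤_) [A+D]δ≡ε
             (*-close {s m} {t m} {s n} {t n} {A} {D} {δ}
               (hA m (ℕ.m⊔n≤o⇒m≤o K L p₁)) (hD n (ℕ.m⊔n≤o⇒n≤o K L q₁))
               (hs m n (ℕ.m⊔n≤o⇒m≤o M N p₂) (ℕ.m⊔n≤o⇒m≤o M N q₂))
               (ht m n (ℕ.m⊔n≤o⇒n≤o M N p₂) (ℕ.m⊔n≤o⇒n≤o M N q₂)))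

    recip-cauchy : ∀ {s δ} → Cauchy s → 0ℚ ℚ.< δ → Eventually (λ n → δ ℚ.≤ s n) →
                   Cauchy λ n → recip (s n)
    recip-cauchy {s} {δ} cs 0<δ (M , hδ) {ε} 0<ε
      with cs (*-pos {δ ℚ.* δ} {ε} (*-pos {δ} {δ} 0<δ 0<δ) 0<ε)
    ... | N , h = M ℕ.⊔ N , λ m n p q →
      recip-close {s m} {s n} 0<δ (hδ m (ℕ.m⊔n≤o⇒m≤o M N p)) (hδ n (ℕ.m⊔n≤o⇒m≤o M N q))
                  (h m n (ℕ.m⊔n≤o⇒n≤o M N p) (ℕ.m⊔n≤o⇒n≤o M N q))

    sqrt-cauchy : ∀ {s} → Cauchy s → Cauchy λ n → sqrt n (s n)
    sqrt-cauchy {s} cs {ε} 0<ε =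
      let M , hu = unit-small (half 0<ε)
          N , h  = cs (*-pos {½ ℚ.* ε} {½ ℚ.* ε} (half 0<ε) (half 0<ε))
      in M ℕ.⊔ N , λ m n p q →
      let p₁ = ℕ.m⊔n≤o⇒m≤o M N p ; p₂ = ℕ.m⊔n≤o⇒n≤o M N p
          q₁ = ℕ.m⊔n≤o⇒m≤o M N q ; q₂ = ℕ.m⊔n≤o⇒n≤o M N q
      in ≤⇒∣-∣ {sqrt m (s m)} {sqrt n (s n)}
               (sqrt-mono m n (s m) (s n) 0<ε (hu n q₁) (∣-∣⇒≤ {s m} {s n} (h m n p₂ q₂)))
               (sqrt-mono n m (s n) (s m) 0<ε (hu m p₁) (∣-∣⇒≤ {s n} {s m} (h n m q₂ p₂)))

    const-cauchy : ∀ q → Cauchy λ _ → q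
    const-cauchy q 0<ε = 0 , λ _ _ _ _ →
      subst (ℚ._≤ _) (sym (cong ℚ.∣_∣ (ℚ.+-inverseʳ q))) (ℚ.<⇒≤ 0<ε)

fromℚ : ℚ → ℝ
fromℚ q = mkℝ (λ _ → q) (const-cauchy q)

fromℕ : ℕ → ℝ
fromℕ n = fromℚ (+ n ℚ./ 1)

0ℝ 1ℝ : ℝ
0ℝ = fromℚ 0ℚ
1ℝ = fromℚ 1ℚ

infix  8 -_
infixl 7 _*_
infixl 6 _+_ _-_

_+_ : ℝ → ℝ → ℝ
x + y = mkℝ (λ n → seq x n ℚ.+ seq y n) (+-cauchy {seq x} {seq y} (cauchy x) (cauchy y))

-_ : ℝ → ℝ
- x = mkℝ (λ n → ℚ.- seq x n) (neg-cauchy {seq x} (cauchy x))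

_-_ : ℝ → ℝ → ℝ
x - y = x + - y

_*_ : ℝ → ℝ → ℝ
x * y = mkℝ (λ n → seq x n ℚ.* seq y n) (*-cauchy {seq x} {seq y} (cauchy x) (cauchy y))

inverse : ∀ x → 0ℝ < x → ℝ
inverse x (mk< δ 0<δ (N , h)) = mkℝ (λ n → recip (seq x n))
  (recip-cauchy {seq x} (cauchy x) 0<δ
    (N , λ n N≤n → subst (ℚ._≤ seq x n) (ℚ.+-identityˡ δ) (h n N≤n)))

infixl 7 _/_[_]

_/_[_] : ∀ x y → 0ℝ < y → ℝ
x / y [ 0<y ] = x * inverse y 0<y

*-pos : ∀ {x y} → 0ℝ < x → 0ℝ < y → 0ℝ < x * y
*-pos {x} {y} (mk< δ 0<δ (M , hx)) (mk< η 0<η (N , hy)) =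
  mk< (δ ℚ.* η) (ℚ-Lemmas.*-pos 0<δ 0<η) (M ℕ.⊔ N , λ n p →
    subst (ℚ._≤ seq x n ℚ.* seq y n) (sym (ℚ.+-identityˡ (δ ℚ.* η)))
      (ℚ-Lemmas.*-mono-≤
        (ℚ.<⇒≤ 0<δ) (subst (ℚ._≤ seq x n) (ℚ.+-identityˡ δ) (hx n (ℕ.m⊔n≤o⇒m≤o M N p)))
        (ℚ.<⇒≤ 0<η) (subst (ℚ._≤ seq y n) (ℚ.+-identityˡ η) (hy n (ℕ.m⊔n≤o⇒n≤o M N p)))))

-- The n-th term is within 1 / (n + 1) of the root of the n-th term of x;
-- negative x are sent to 0.
√ : ℝ → ℝ
√ x = mkℝ (λ n → sqrt n (seq x n)) (sqrt-cauchy {seq x} (cauchy x))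

IsInfimum : Pred ℝ ℓ → ℝ → Set ℓ
IsInfimum S m = (∀ s → S s → m ≤ s) × (∀ l → (∀ s → S s → l ≤ s) → l ≤ m)

------------------------------------------------------------------------
-- Complex numbers

infix 4 _≈ᶜ_ _≉ᶜ_

record ℂ : Set where
  constructor mkℂ
  field
    re im : ℝ

open ℂ public

_≈ᶜ_ _≉ᶜ_ : ℂ → ℂ → Set
z ≈ᶜ w = re z ≈ re w × im z ≈ im w
z ≉ᶜ w = ¬ (z ≈ᶜ w)

0ℂ 1ℂ : ℂ
0ℂ = mkℂ 0ℝ 0ℝ
1ℂ = mkℂ 1ℝ 0ℝ

infixl 7 _*ᶜ_
infixl 6 _-ᶜ_

_-ᶜ_ : ℂ → ℂ → ℂ
z -ᶜ w = mkℂ (re z - re w) (im z - im w)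

_*ᶜ_ : ℂ → ℂ → ℂ
z *ᶜ w = mkℂ (re z * re w - im z * im w) (re z * im w + im z * re w)

∣_∣ : ℂ → ℝ
∣ z ∣ = √ (re z * re z + im z * im z)

infix 5 _∖0

_∖0 : Pred ℂ ℓ → Pred ℂ ℓ
(R ∖0) z = R z × z ≉ᶜ 0ℂ

absoluteValues : Pred ℂ ℓ → Pred ℝ ℓ
absoluteValues S r = ∃[ z ] S z × r ≈ ∣ z ∣

------------------------------------------------------------------------
-- Frieze patterns

InRange : ℕ → ℤ → ℤ → Set
InRange n i j = i ℤ.≤ j × j ℤ.≤ i ℤ.+ + (n ℕ.+ 3)

-- A family indexed by i ≤ j ≤ i + n + 3 is represented by a function on all
-- pairs of integers, whose values outside this range are unconstrained.
record IsFriezePattern (S : Pred ℂ ℓ) (n : ℕ) (c : ℤ → ℤ → ℂ) : Set ℓ where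
  field
    left-zero   : ∀ i → c i i ≈ᶜ 0ℂ
    right-zero  : ∀ i → c i (i ℤ.+ + (n ℕ.+ 3)) ≈ᶜ 0ℂ
    left-one    : ∀ i → c i (i ℤ.+ + 1) ≈ᶜ 1ℂ
    right-one   : ∀ i → c i (i ℤ.+ + (n ℕ.+ 2)) ≈ᶜ 1ℂ
    entry       : ∀ i j → i ℤ.+ + 2 ℤ.≤ j → j ℤ.≤ i ℤ.+ + (n ℕ.+ 1) → S (c i j)
    determinant : ∀ i j →
      InRange n i j → InRange n (ℤ.suc i) (ℤ.suc j) →
      InRange n i (ℤ.suc j) → InRange n (ℤ.suc i) j →
      c i j *ᶜ c (ℤ.suc i) (ℤ.suc j) -ᶜ c i (ℤ.suc j) *ᶜ c (ℤ.suc i) j ≈ᶜ 1ℂ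

quiddity : (ℤ → ℤ → ℂ) → ℤ → ℂ
quiddity c i = c i (i ℤ.+ + 2)

-- Fix i and write a = c i and b = c (i + 1) for two adjacent rows. The determinant
-- condition reads a_j / b_j − a_{j+1} / b_{j+1} = 1 / (b_j b_{j+1}), and telescoping it
-- up to a_{i+n+3} = 0 expresses a_{i+2}, as b_{i+2} = 1, as the sum of 1 / (b_j b_{j+1})
-- over i + 2 ≤ j ≤ i + n + 2. Since b_{i+2} = b_{i+n+3} = 1 and the other b_j have modulus
-- at least M, the two extreme terms are at most 1 / M and the n − 1 others at most 1 / M²
-- in modulus. To avoid complex division, the bounds on the ratios are carried through the
-- recursion |a_j| |b_{j+1}| ≤ 1 + |a_{j+1}| |b_j| in the form |a_j| ≤ |b_j| s.

module Submission where

import Data.Integer.Properties as ℤ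
import Data.Nat.Base as ℕ
import Data.Nat.Properties as ℕ
open import Data.Product.Base using (_,_)
open import Data.Rational.Base as ℚ using (ℚ; 0ℚ; 1ℚ; ½)
import Data.Rational.Properties as ℚ
open import Data.Rational.Solver using (module +-*-Solver)
open import Data.Sum.Base using (inj₁; inj₂)
open import Function.Base using (_∘_)
open import Relation.Binary.Bundles using (Poset)
open import Relation.Binary.PropositionalEquality as ≡
  using (_≡_; refl; cong; subst; subst₂)
import Relation.Binary.Reasoning.PartialOrder
open +-*-Solver using (solve; _:=_; _:+_; _:*_; :-_; _:-_; con)

-- Rational estimates

module _ where

  open import Data.Rational.Base using (_≤_; _<_; _+_; _*_; _-_; -_; ∣_∣)
  open import Defs using (module ℚ-Lemmas)
  open ℚ-Lemmas
  open ℚ.≤-Reasoning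

  0≤p*q : ∀ {p q} → 0ℚ ≤ p → 0ℚ ≤ q → 0ℚ ≤ p * q
  0≤p*q 0≤p 0≤q = *-mono-≤ {r = 0ℚ} ℚ.≤-refl 0≤p ℚ.≤-refl 0≤q

  0≤-p*-q : ∀ {p q} → p ≤ 0ℚ → q ≤ 0ℚ → 0ℚ ≤ p * q
  0≤-p*-q {p} {q} p≤0 q≤0 =
    subst (0ℚ ≤_) (solve 2 (λ p q → :- p :* :- q := p :* q) refl p q)
      (0≤p*q (ℚ.neg-antimono-≤ p≤0) (ℚ.neg-antimono-≤ q≤0))

  0≤p*p : ∀ p → 0ℚ ≤ p * p
  0≤p*p p with ℚ.≤-total 0ℚ p
  ... | inj₁ 0≤p = 0≤p*q 0≤p 0≤p
  ... | inj₂ p≤0 = 0≤-p*-q p≤0 p≤0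

  p≤p+q : ∀ p {q} → 0ℚ ≤ q → p ≤ p + q
  p≤p+q p {q} 0≤q = subst (_≤ p + q) (ℚ.+-identityʳ p) (ℚ.+-monoʳ-≤ p 0≤q)

  -- If one factor is nonnegative, multiplying it by the other factor shifted by `δ` costs at most
  -- `B * δ`; two nonpositive factors cost nothing. This is the termwise form of positivity of
  -- products, since the terms of a nonnegative real may be slightly negative.
  *-almost-nonNeg : ∀ {p q δ B} → 0ℚ ≤ δ → 0ℚ ≤ p + δ → 0ℚ ≤ q + δ →
                    ∣ p ∣ ≤ B → ∣ q ∣ ≤ B → 0ℚ ≤ p * q + B * δ
  *-almost-nonNeg {p} {q} {δ} {B} 0≤δ 0≤p+δ 0≤q+δ p≤B q≤B
    with ℚ.≤-total 0ℚ q | ℚ.≤-total 0ℚ p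
  ... | inj₁ 0≤q | _ = begin
    0ℚ             ≤⟨ 0≤p*q 0≤p+δ 0≤q ⟩
    (p + δ) * q    ≡⟨ solve 3 (λ p q δ → (p :+ δ) :* q := p :* q :+ q :* δ) refl p q δ ⟩
    p * q + q * δ  ≤⟨ ℚ.+-monoʳ-≤ (p * q) (ℚ.*-monoʳ-≤-nonNeg δ {{ℚ.nonNegative 0≤δ}}
                        (ℚ.≤-trans (p≤∣p∣ q) q≤B)) ⟩
    p * q + B * δ  ∎
  ... | inj₂ _ | inj₁ 0≤p = begin
    0ℚ             ≤⟨ 0≤p*q 0≤q+δ 0≤p ⟩
    (q + δ) * p    ≡⟨ solve 3 (λ p q δ → (q :+ δ) :* p := p :* q :+ p :* δ) refl p q δ ⟩
    p * q + p * δ  ≤⟨ ℚ.+-monoʳ-≤ (p * q) (ℚ.*-monoʳ-≤-nonNeg δ {{ℚ.nonNegative 0≤δ}}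
                        (ℚ.≤-trans (p≤∣p∣ p) p≤B)) ⟩
    p * q + B * δ  ∎
  ... | inj₂ q≤0 | inj₂ p≤0 = begin
    0ℚ             ≤⟨ 0≤-p*-q p≤0 q≤0 ⟩
    p * q          ≤⟨ p≤p+q (p * q) (0≤p*q (ℚ.≤-trans (ℚ.0≤∣p∣ p) p≤B) 0≤δ) ⟩
    p * q + B * δ  ∎

  -- The square of `q + 4δ` exceeds `q * q + δ * δ` by `8δ * (q + δ) + 7δ * δ`, which is positive,
  -- so strict cancellation of squares applies.
  square-almost-cancel-≤ : ∀ {p q δ} → 0ℚ < δ → 0ℚ ≤ q + δ →
                           p * p ≤ q * q + δ * δ → p ≤ q + ((δ + δ) + (δ + δ))
  square-almost-cancel-≤ {p} {q} {δ} 0<δ 0≤q+δ pp≤qq+δδ =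
    ℚ.<⇒≤ (square-cancel-< 0≤r (begin-strict
      p * p                        ≤⟨ pp≤qq+δδ ⟩
      q * q + δ * δ                ≡⟨ ℚ.+-identityʳ _ ⟨
      q * q + δ * δ + 0ℚ           <⟨ ℚ.+-monoʳ-< (q * q + δ * δ) 0<rest ⟩
      q * q + δ * δ + (8δ * (q + δ) + 7δ * δ)
        ≡⟨ solve 2 (λ q δ → let 2d = δ :+ δ ; 4d = 2d :+ 2d in
             q :* q :+ δ :* δ :+ ((4d :+ 4d) :* (q :+ δ) :+ (4d :+ (2d :+ δ)) :* δ)
             := (q :+ 4d) :* (q :+ 4d)) refl q δ ⟩
      r * r                        ∎))
    where
    2δ = δ + δ
    4δ = 2δ + 2δ
    8δ = 4δ + 4δ
    7δ = 4δ + (2δ + δ)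
    r = q + 4δ
    0<2δ = +-pos 0<δ 0<δ
    0<4δ = +-pos 0<2δ 0<2δ
    0<8δ = +-pos 0<4δ 0<4δ
    0<7δ = +-pos 0<4δ (+-pos 0<2δ 0<δ)
    0<rest : 0ℚ < 8δ * (q + δ) + 7δ * δ
    0<rest = ℚ.+-mono-≤-< (0≤p*q (ℚ.<⇒≤ 0<8δ) 0≤q+δ) (*-pos 0<7δ 0<δ)
    0≤r : 0ℚ ≤ r
    0≤r = begin
      0ℚ                 ≤⟨ 0≤q+δ ⟩
      q + δ              ≤⟨ p≤p+q (q + δ) (ℚ.<⇒≤ (+-pos 0<2δ 0<δ)) ⟩
      q + δ + (2δ + δ)   ≡⟨ solve 2 (λ q δ → q :+ δ :+ ((δ :+ δ) :+ δ)
                              := q :+ ((δ :+ δ) :+ (δ :+ δ))) refl q δ ⟩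
      r                  ∎

  p≤sqrt*sqrt+ : ∀ n p {B δ} → sqrt n p ≤ B → unit n ≤ 1ℚ → unit n ≤ δ →
                 p ≤ sqrt n p * sqrt n p + (B + B + 1ℚ) * δ
  p≤sqrt*sqrt+ n p {B} {δ} s≤B u≤1 u≤δ = begin
    p                          ≤⟨ ℚ.<⇒≤ (sqrt-upper n p) ⟩
    (s + u) * (s + u)          ≡⟨ solve 2 (λ s u → (s :+ u) :* (s :+ u)
                                    := s :* s :+ (s :+ s :+ u) :* u) refl s u ⟩
    s * s + (s + s + u) * u    ≤⟨ ℚ.+-monoʳ-≤ (s * s) (*-mono-≤
                                    (ℚ.+-mono-≤ (ℚ.+-mono-≤ 0≤s 0≤s) 0≤u)
                                    (ℚ.+-mono-≤ (ℚ.+-mono-≤ s≤B s≤B) u≤1) 0≤u u≤δ) ⟩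
    s * s + (B + B + 1ℚ) * δ   ∎
    where
    s = sqrt n p
    u = unit n
    0≤s = sqrt-nonNeg n p
    0≤u = ℚ.<⇒≤ (0<unit n)

  -- The root of a negative `p` is 0 by default and its square is not below `p`; the hypothesis on
  -- `p + ε` covers this case.
  sqrt*sqrt≤ : ∀ n p {ε} → 0ℚ ≤ ε → 0ℚ ≤ p + ε → sqrt n p * sqrt n p ≤ p + ε
  sqrt*sqrt≤ n p 0≤ε 0≤p+ε with sqrt-lower n p
  ... | inj₁ s≡0 = subst (λ s → s * s ≤ _) (≡.sym s≡0) 0≤p+ε
  ... | inj₂ ss≤p = ℚ.≤-trans ss≤p (p≤p+q p 0≤ε)

open import Defs
open import Data.Integer.Base as ℤ using (ℤ; +_)
open import Data.Nat.Base using (ℕ; zero; suc; NonZero)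
open import Level using (Level; 0ℓ)
open import Relation.Binary.Definitions using (_Respects_)
open import Relation.Unary using (Pred)

open ℚ-Lemmas using (∣-∣⇒≤; ≤⇒∣-∣; half; half+half; divide-pos; unit-small)

-- The ordered ring of real numbers

Eventually-map₂ : ∀ {P Q S : Pred ℕ 0ℓ} → (∀ n → P n → Q n → S n) →
                  Eventually P → Eventually Q → Eventually S
Eventually-map₂ f (M , p) (N , q) = M ℕ.⊔ N , λ n h →
  f n (p n (ℕ.m⊔n≤o⇒m≤o M N h)) (q n (ℕ.m⊔n≤o⇒n≤o M N h))

Eventually-map : ∀ {P Q : Pred ℕ 0ℓ} → (∀ n → P n → Q n) → Eventually P → Eventually Q
Eventually-map f (N , p) = N , λ n N≤n → f n (p n N≤n)

eventually⇒≤ : ∀ {x y} → Eventually (λ n → seq x n ℚ.≤ seq y n) → x ≤ y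
eventually⇒≤ h = mk≤ λ ε 0<ε → Eventually-map (λ n x≤y → ℚ.≤-trans x≤y (p≤p+q _ (ℚ.<⇒≤ 0<ε))) h

≤-antisym : ∀ {x y} → x ≤ y → y ≤ x → x ≈ y
≤-antisym {x} {y} (mk≤ f) (mk≤ g) = mk≈ λ ε 0<ε →
  Eventually-map₂ (λ n → ≤⇒∣-∣ {seq x n} {seq y n}) (f ε 0<ε) (g ε 0<ε)

≤-trans : ∀ {x y z} → x ≤ y → y ≤ z → x ≤ z
≤-trans {x} {y} {z} (mk≤ f) (mk≤ g) = mk≤ λ ε 0<ε →
  Eventually-map₂
    (λ n x≤y y≤z → subst (seq x n ℚ.≤_)
      (≡.trans (ℚ.+-assoc (seq z n) _ _) (cong (seq z n ℚ.+_) (half+half ε)))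
      (ℚ.≤-trans x≤y (ℚ.+-monoˡ-≤ (½ ℚ.* ε) y≤z)))
    (f (½ ℚ.* ε) (half 0<ε)) (g (½ ℚ.* ε) (half 0<ε))

≈⇒≤ : ∀ {x y} → x ≈ y → x ≤ y
≈⇒≤ {x} {y} (mk≈ f) = mk≤ λ ε 0<ε →
  Eventually-map (λ n → ∣-∣⇒≤ {seq x n} {seq y n}) (f ε 0<ε)

≈-sym : ∀ {x y} → x ≈ y → y ≈ x
≈-sym {x} {y} (mk≈ f) = mk≈ λ ε 0<ε →
  Eventually-map (λ n → subst (ℚ._≤ ε) (ℚ-Lemmas.∣p-q∣≡∣q-p∣ (seq x n) (seq y n))) (f ε 0<ε)

≤-refl : ∀ {x} → x ≤ x
≤-refl = eventually⇒≤ (0 , λ _ _ → ℚ.≤-refl)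

≈-refl : ∀ {x} → x ≈ x
≈-refl = ≤-antisym ≤-refl ≤-refl

≈-trans : ∀ {x y z} → x ≈ y → y ≈ z → x ≈ z
≈-trans x≈y y≈z = ≤-antisym (≤-trans (≈⇒≤ x≈y) (≈⇒≤ y≈z))
                            (≤-trans (≈⇒≤ (≈-sym y≈z)) (≈⇒≤ (≈-sym x≈y)))

≤-poset : Poset _ _ _
≤-poset = record
  { _≈_ = _≈_
  ; _≤_ = _≤_
  ; isPartialOrder = record
    { isPreorder = record
      { isEquivalence = record
        { refl = ≈-refl ; sym = ≈-sym ; trans = ≈-trans }
      ; reflexive = ≈⇒≤
      ; trans = ≤-trans
      }
    ; antisym = ≤-antisym
    }
  }

module ≤-Reasoning = Relation.Binary.Reasoning.PartialOrder ≤-poset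

eventually⇒≈ : ∀ {x y} → Eventually (λ n → seq x n ≡ seq y n) → x ≈ y
eventually⇒≈ h = ≤-antisym (eventually⇒≤ (Eventually-map (λ _ → ℚ.≤-reflexive) h))
                           (eventually⇒≤ (Eventually-map (λ _ → ℚ.≤-reflexive ∘ ≡.sym) h))

-- Since the operations act termwise, ring identities are inherited from ℚ.
termwise : ∀ {x y} → (∀ n → seq x n ≡ seq y n) → x ≈ y
termwise h = eventually⇒≈ (0 , λ n _ → h n)

-- Compatibility of addition and multiplication with order and equality

+-mono-≤ : ∀ {x y z w} → x ≤ y → z ≤ w → x + z ≤ y + w
+-mono-≤ {x} {y} {z} {w} (mk≤ f) (mk≤ g) = mk≤ λ ε 0<ε →
  Eventually-map₂
    (λ n x≤y z≤w → subst (seq x n ℚ.+ seq z n ℚ.≤_)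
      (≡.trans
        (solve 3 (λ y w d → (y :+ d) :+ (w :+ d) := y :+ w :+ (d :+ d)) refl
          (seq y n) (seq w n) (½ ℚ.* ε))
        (cong (seq y n ℚ.+ seq w n ℚ.+_) (half+half ε)))
      (ℚ.+-mono-≤ x≤y z≤w))
    (f (½ ℚ.* ε) (half 0<ε)) (g (½ ℚ.* ε) (half 0<ε))

+-monoˡ-≤ : ∀ z {x y} → x ≤ y → x + z ≤ y + z
+-monoˡ-≤ z x≤y = +-mono-≤ x≤y ≤-refl

+-cong : ∀ {x y z w} → x ≈ y → z ≈ w → x + z ≈ y + w
+-cong x≈y z≈w = ≤-antisym (+-mono-≤ (≈⇒≤ x≈y) (≈⇒≤ z≈w))
                           (+-mono-≤ (≈⇒≤ (≈-sym x≈y)) (≈⇒≤ (≈-sym z≈w)))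

+-nonNeg : ∀ {x y} → 0ℝ ≤ x → 0ℝ ≤ y → 0ℝ ≤ x + y
+-nonNeg 0≤x 0≤y = ≤-trans {y = 0ℝ + 0ℝ} (eventually⇒≤ (0 , λ _ _ → ℚ.≤-refl)) (+-mono-≤ 0≤x 0≤y)

*-nonNeg : ∀ {x y} → 0ℝ ≤ x → 0ℝ ≤ y → 0ℝ ≤ x * y
*-nonNeg {x} {y} (mk≤ f) (mk≤ g) with cauchy-bounded {seq x} (cauchy x) | cauchy-bounded {seq y} (cauchy y)
... | A , 0<A , x≤A | B , 0<B , y≤B = mk≤ λ ε 0<ε →
  -- `A + B` eventually bounds both factors, so the error of the termwise estimate is exactly `ε`.
  let δ , 0<δ , [A+B]δ≡ε = divide-pos {A ℚ.+ B} (ℚ-Lemmas.+-pos 0<A 0<B) 0<ε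
  in Eventually-map₂
       (λ n (0≤x , 0≤y) (x≤ , y≤) →
         subst (λ e → 0ℚ ℚ.≤ seq x n ℚ.* seq y n ℚ.+ e) [A+B]δ≡ε
           (*-almost-nonNeg {seq x n} {seq y n} (ℚ.<⇒≤ 0<δ) 0≤x 0≤y
             (ℚ.≤-trans x≤ (p≤p+q A (ℚ.<⇒≤ 0<B)))
             (ℚ.≤-trans y≤ (subst (B ℚ.≤_) (ℚ.+-comm B A) (p≤p+q B (ℚ.<⇒≤ 0<A))))))
       (Eventually-map₂ (λ _ → _,_) (f δ 0<δ) (g δ 0<δ))
       (Eventually-map₂ (λ _ → _,_) x≤A y≤B)

x≤y⇒0≤y-x : ∀ {x y} → x ≤ y → 0ℝ ≤ y - x
x≤y⇒0≤y-x {x} {y} x≤y = begin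
  0ℝ     ≈⟨ termwise (λ n → ≡.sym (ℚ.+-inverseʳ (seq x n))) ⟩
  x - x  ≤⟨ +-monoˡ-≤ (- x) x≤y ⟩
  y - x  ∎
  where open ≤-Reasoning

0≤y-x⇒x≤y : ∀ {x y} → 0ℝ ≤ y - x → x ≤ y
0≤y-x⇒x≤y {x} {y} 0≤y-x = begin
  x            ≈⟨ termwise (λ n → ≡.sym (ℚ.+-identityˡ (seq x n))) ⟩
  0ℝ + x       ≤⟨ +-monoˡ-≤ x 0≤y-x ⟩
  y - x + x    ≈⟨ termwise (λ n → solve 2 (λ x y → y :- x :+ x := y) refl (seq x n) (seq y n)) ⟩
  y            ∎
  where open ≤-Reasoning

*-monoˡ-≤ : ∀ {x y z} → 0ℝ ≤ z → x ≤ y → x * z ≤ y * z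
*-monoˡ-≤ {x} {y} {z} 0≤z x≤y = 0≤y-x⇒x≤y (begin
  0ℝ             ≤⟨ *-nonNeg (x≤y⇒0≤y-x x≤y) 0≤z ⟩
  (y - x) * z    ≈⟨ termwise (λ n → solve 3 (λ x y z → (y :- x) :* z := y :* z :- x :* z) refl
                      (seq x n) (seq y n) (seq z n)) ⟩
  y * z - x * z  ∎)
  where open ≤-Reasoning

*-comm : ∀ x y → x * y ≈ y * x
*-comm x y = termwise λ n → ℚ.*-comm (seq x n) (seq y n)

*-mono-≤ : ∀ {x y z w} → 0ℝ ≤ z → 0ℝ ≤ y → x ≤ y → z ≤ w → x * z ≤ y * w
*-mono-≤ {x} {y} {z} {w} 0≤z 0≤y x≤y z≤w = begin
  x * z  ≤⟨ *-monoˡ-≤ 0≤z x≤y ⟩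
  y * z  ≈⟨ *-comm y z ⟩
  z * y  ≤⟨ *-monoˡ-≤ 0≤y z≤w ⟩
  w * y  ≈⟨ *-comm w y ⟩
  y * w  ∎
  where open ≤-Reasoning

-- The sign of `z` is unknown, so monotonicity cannot be used; instead `z` is eventually bounded by
-- some `B`, and `δ` is chosen with `B * δ` equal to `ε`.
*-congˡ : ∀ {x y} z → x ≈ y → x * z ≈ y * z
*-congˡ {x} {y} z (mk≈ f) = mk≈ λ ε 0<ε →
  let B , 0<B , z≤B = cauchy-bounded {seq z} (cauchy z)
      δ , 0<δ , Bδ≡ε = divide-pos 0<B 0<ε
  in Eventually-map₂
       (λ n x-y≤δ z≤ → subst₂ ℚ._≤_
         (≡.trans (≡.sym (ℚ.∣p*q∣≡∣p∣*∣q∣ (seq z n) (seq x n ℚ.- seq y n)))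
           (cong ℚ.∣_∣ (solve 3 (λ x y z → z :* (x :- y) := x :* z :- y :* z) refl
             (seq x n) (seq y n) (seq z n))))
         Bδ≡ε
         (ℚ-Lemmas.*-mono-≤ (ℚ.0≤∣p∣ (seq z n)) z≤ (ℚ.0≤∣p∣ (seq x n ℚ.- seq y n)) x-y≤δ))
       (f δ 0<δ) z≤B

*-cong : ∀ {x y z w} → x ≈ y → z ≈ w → x * z ≈ y * w
*-cong {x} {y} {z} {w} x≈y z≈w = begin-equality
  x * z  ≈⟨ *-congˡ z x≈y ⟩
  y * z  ≈⟨ *-comm y z ⟩
  z * y  ≈⟨ *-congˡ y z≈w ⟩
  w * y  ≈⟨ *-comm w y ⟩
  y * w  ∎
  where open ≤-Reasoning

-- Strict positivity, cancellation and inverses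

0<⇒eventually : ∀ {x} (0<x : 0ℝ < x) → Eventually λ n → _<_.gap 0<x ℚ.≤ seq x n
0<⇒eventually {x} (mk< δ _ h) = Eventually-map (λ n → subst (ℚ._≤ seq x n) (ℚ.+-identityˡ δ)) h

<⇒≤ : ∀ {x} → 0ℝ < x → 0ℝ ≤ x
<⇒≤ 0<x = eventually⇒≤ (Eventually-map (λ _ → ℚ.≤-trans (ℚ.<⇒≤ (_<_.0<gap 0<x))) (0<⇒eventually 0<x))

<-≤-trans : ∀ {x y} → 0ℝ < x → x ≤ y → 0ℝ < y
<-≤-trans {x} {y} 0<x@(mk< δ 0<δ _) (mk≤ f) = mk< (½ ℚ.* δ) (half 0<δ)
  (Eventually-map₂
    (λ n δ≤x x≤y → subst (ℚ._≤ seq y n) (≡.sym (ℚ.+-identityˡ (½ ℚ.* δ)))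
      (+-cancelʳ (½ ℚ.* δ) (subst (ℚ._≤ seq y n ℚ.+ ½ ℚ.* δ) (≡.sym (half+half δ)) (ℚ.≤-trans δ≤x x≤y))))
    (0<⇒eventually 0<x) (f (½ ℚ.* δ) (half 0<δ)))
  where
  +-cancelʳ : ∀ r {p q} → p ℚ.+ r ℚ.≤ q ℚ.+ r → p ℚ.≤ q
  +-cancelʳ r {p} {q} h = subst₂ ℚ._≤_ (cancel p) (cancel q) (ℚ.+-monoˡ-≤ (ℚ.- r) h)
    where
    cancel : ∀ p → p ℚ.+ r ℚ.- r ≡ p
    cancel p = solve 2 (λ p r → p :+ r :- r := p) refl p r

-- Tolerance `ε * δ` is requested for the products, where `δ` is the gap of `z`: eventually it is at
-- most `ε * z`, so cancelling the terms of `z` leaves the tolerance `ε`.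
*-cancelʳ-≤ : ∀ {x y z} → 0ℝ < z → x * z ≤ y * z → x ≤ y
*-cancelʳ-≤ {x} {y} {z} 0<z@(mk< δ 0<δ _) (mk≤ f) = mk≤ λ ε 0<ε →
  Eventually-map₂
    (λ n δ≤z xz≤yz → ℚ.*-cancelʳ-≤-pos (seq z n) {{ℚ.positive (ℚ.<-≤-trans 0<δ δ≤z)}}
      (ℚ.≤-trans xz≤yz (subst (seq y n ℚ.* seq z n ℚ.+ ε ℚ.* δ ℚ.≤_)
        (≡.sym (ℚ.*-distribʳ-+ (seq z n) (seq y n) ε))
        (ℚ.+-monoʳ-≤ (seq y n ℚ.* seq z n)
          (ℚ.*-monoˡ-≤-nonNeg ε {{ℚ.nonNegative (ℚ.<⇒≤ 0<ε)}} δ≤z)))))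
    (0<⇒eventually 0<z) (f (ε ℚ.* δ) (ℚ-Lemmas.*-pos 0<ε 0<δ))

-- Equality of terms is claimed only once the terms of `x` are past the gap; an earlier term may be
-- 0, where `recip` takes its default value 0.
*-inverseʳ : ∀ x (0<x : 0ℝ < x) → x * inverse x 0<x ≈ 1ℝ
*-inverseʳ x 0<x@(mk< _ 0<δ _) = eventually⇒≈
  (Eventually-map (λ n δ≤x → ℚ-Lemmas.*-recip (ℚ.<-≤-trans 0<δ δ≤x)) (0<⇒eventually 0<x))

0≤1 : 0ℝ ≤ 1ℝ
0≤1 = eventually⇒≤ (0 , λ _ _ → ℚ.<⇒≤ (ℚ.positive⁻¹ 1ℚ))

inverse-nonNeg : ∀ x (0<x : 0ℝ < x) → 0ℝ ≤ inverse x 0<x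
inverse-nonNeg x 0<x = *-cancelʳ-≤ 0<x (begin
  0ℝ * x             ≈⟨ termwise (λ n → ℚ.*-zeroˡ (seq x n)) ⟩
  0ℝ                 ≤⟨ 0≤1 ⟩
  1ℝ                 ≈⟨ *-inverseʳ x 0<x ⟨
  x * inverse x 0<x  ≈⟨ *-comm x (inverse x 0<x) ⟩
  inverse x 0<x * x  ∎)
  where open ≤-Reasoning

-- Square roots

square-cancel-≤ : ∀ {x y} → 0ℝ ≤ y → x * x ≤ y * y → x ≤ y
square-cancel-≤ {x} {y} (mk≤ f) (mk≤ g) = mk≤ λ ε 0<ε →
  -- A quarter of `ε`, because the rational estimate loses `4δ`.
  let δ = ½ ℚ.* (½ ℚ.* ε)
      0<δ = half (half 0<ε)
      4δ≡ε = ≡.trans (≡.cong₂ ℚ._+_ (half+half (½ ℚ.* ε)) (half+half (½ ℚ.* ε))) (half+half ε)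
  in Eventually-map₂
       (λ n 0≤y+δ xx≤yy → subst (λ e → seq x n ℚ.≤ seq y n ℚ.+ e) 4δ≡ε
         (square-almost-cancel-≤ {seq x n} {seq y n} 0<δ 0≤y+δ xx≤yy))
       (f δ 0<δ) (g (δ ℚ.* δ) (ℚ-Lemmas.*-pos 0<δ 0<δ))

0≤x*x : ∀ x → 0ℝ ≤ x * x
0≤x*x x = eventually⇒≤ (0 , λ n _ → 0≤p*p (seq x n))

√-nonNeg : ∀ x → 0ℝ ≤ √ x
√-nonNeg x = eventually⇒≤ (0 , λ n _ → ℚ-Lemmas.sqrt-nonNeg n (seq x n))

√*√≈ : ∀ {x} → 0ℝ ≤ x → √ x * √ x ≈ x
√*√≈ {x} (mk≤ f) = ≤-antisym lower upper
  where
  lower : √ x * √ x ≤ x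
  lower = mk≤ λ ε 0<ε → Eventually-map (λ n → sqrt*sqrt≤ n (seq x n) (ℚ.<⇒≤ 0<ε)) (f ε 0<ε)
  upper : x ≤ √ x * √ x
  upper = mk≤ λ ε 0<ε →
    -- Rounding a root `s` down by less than `u` changes its square by less than `(s + s + u) * u`;
    -- for `s` at most `B` and `u` at most 1 and `δ`, this is within `(B + B + 1) * δ`, which is
    -- `ε`.
    let B , 0<B , √x≤B = cauchy-bounded {seq (√ x)} (cauchy (√ x))
        δ , 0<δ , Cδ≡ε = divide-pos {B ℚ.+ B ℚ.+ 1ℚ}
                           (ℚ-Lemmas.+-pos (ℚ-Lemmas.+-pos 0<B 0<B) (ℚ.positive⁻¹ 1ℚ)) 0<ε
    in Eventually-map₂
         (λ n √x≤ (u≤1 , u≤δ) → subst (λ e → seq x n ℚ.≤ seq (√ x) n ℚ.* seq (√ x) n ℚ.+ e) Cδ≡ε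
           (p≤sqrt*sqrt+ n (seq x n) (ℚ.≤-trans (ℚ-Lemmas.p≤∣p∣ (seq (√ x) n)) √x≤) u≤1 u≤δ))
         √x≤B
         (Eventually-map₂ (λ _ → _,_) (unit-small (ℚ.positive⁻¹ 1ℚ)) (unit-small 0<δ))

-- Both sides are nonnegative with equal squares. Moduli are evaluated through this
-- characterisation, away from rational approximations.
√-unique : ∀ {x y} → 0ℝ ≤ y → y * y ≈ x → √ x ≈ y
√-unique {x} {y} 0≤y yy≈x = ≤-antisym
  (square-cancel-≤ 0≤y (≈⇒≤ √√≈yy)) (square-cancel-≤ (√-nonNeg x) (≈⇒≤ (≈-sym √√≈yy)))
  where
  √√≈yy : √ x * √ x ≈ y * y
  √√≈yy = ≈-trans (√*√≈ (≤-trans (0≤x*x y) (≈⇒≤ yy≈x))) (≈-sym yy≈x)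

opaque
  unfolding ℚ-Lemmas.fromℕ

  -- Unfolding identifies the constant sequence behind the real `fromℕ` with the opaque rational
  -- embedding.
  fromℕ-suc : ∀ n → fromℕ (suc n) ≈ fromℕ n + 1ℝ
  fromℕ-suc n = termwise λ _ → ℚ-Lemmas.fromℕ-suc n

-- Complex absolute values

norm² : ℂ → ℝ
norm² z = re z * re z + im z * im z

-- The real part of `z` times the conjugate of `w`.
dot : ℂ → ℂ → ℝ
dot z w = re z * re w + im z * im w

norm²-nonNeg : ∀ z → 0ℝ ≤ norm² z
norm²-nonNeg z = +-nonNeg (0≤x*x (re z)) (0≤x*x (im z))

∣∣-nonNeg : ∀ z → 0ℝ ≤ ∣ z ∣
∣∣-nonNeg z = √-nonNeg (norm² z)

∣∣*∣∣≈norm² : ∀ z → ∣ z ∣ * ∣ z ∣ ≈ norm² z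
∣∣*∣∣≈norm² z = √*√≈ (norm²-nonNeg z)

∣∣-cong : ∀ {z w} → z ≈ᶜ w → ∣ z ∣ ≈ ∣ w ∣
∣∣-cong {z} {w} (re≈ , im≈) = √-unique (∣∣-nonNeg w) (≈-trans (∣∣*∣∣≈norm² w)
  (≈-sym (+-cong (*-cong re≈ re≈) (*-cong im≈ im≈))))

∣0∣≈0 : ∣ 0ℂ ∣ ≈ 0ℝ
∣0∣≈0 = √-unique ≤-refl (termwise λ _ → refl)

∣1∣≈1 : ∣ 1ℂ ∣ ≈ 1ℝ
∣1∣≈1 = √-unique 0≤1 (termwise λ _ → refl)

interchange : ∀ x y z w → (x * y) * (z * w) ≈ (x * z) * (y * w)
interchange x y z w = termwise λ n →
  solve 4 (λ x y z w → (x :* y) :* (z :* w) := (x :* z) :* (y :* w)) refl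
    (seq x n) (seq y n) (seq z n) (seq w n)

∣∣*∣∣-square : ∀ z w → (∣ z ∣ * ∣ w ∣) * (∣ z ∣ * ∣ w ∣) ≈ norm² z * norm² w
∣∣*∣∣-square z w = ≈-trans (interchange (∣ z ∣) (∣ w ∣) (∣ z ∣) (∣ w ∣))
                           (*-cong (∣∣*∣∣≈norm² z) (∣∣*∣∣≈norm² w))

-- The squared form is the Brahmagupta-Fibonacci two-square identity.
∣∣-* : ∀ z w → ∣ z *ᶜ w ∣ ≈ ∣ z ∣ * ∣ w ∣
∣∣-* z w = √-unique (*-nonNeg (∣∣-nonNeg z) (∣∣-nonNeg w))
  (≈-trans (∣∣*∣∣-square z w) (termwise λ n →
    solve 4 (λ a b c d → (a :* a :+ b :* b) :* (c :* c :+ d :* d) :=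
                         (a :* c :- b :* d) :* (a :* c :- b :* d) :+
                         (a :* d :+ b :* c) :* (a :* d :+ b :* c)) refl
      (seq (re z) n) (seq (im z) n) (seq (re w) n) (seq (im w) n)))

-- By Lagrange's identity, the product of the squared norms exceeds the square of `dot z w` by the
-- square of `cross`.
cauchy-schwarz : ∀ z w → dot z w ≤ ∣ z ∣ * ∣ w ∣
cauchy-schwarz z w = square-cancel-≤ (*-nonNeg (∣∣-nonNeg z) (∣∣-nonNeg w)) (begin
  dot z w * dot z w                              ≤⟨ 0≤y-x⇒x≤y (begin
    0ℝ                                             ≤⟨ 0≤x*x cross ⟩
    cross * cross                                  ≈⟨ termwise (λ n → solve 4 (λ a b c d →
      (a :* d :- b :* c) :* (a :* d :- b :* c) :=
      (a :* a :+ b :* b) :* (c :* c :+ d :* d) :-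
      (a :* c :+ b :* d) :* (a :* c :+ b :* d)) refl
      (seq (re z) n) (seq (im z) n) (seq (re w) n) (seq (im w) n)) ⟩
    norm² z * norm² w - dot z w * dot z w          ∎) ⟩
  norm² z * norm² w                              ≈⟨ ∣∣*∣∣-square z w ⟨
  (∣ z ∣ * ∣ w ∣) * (∣ z ∣ * ∣ w ∣)              ∎)
  where
  open ≤-Reasoning
  cross = re z * im w - im z * re w

-- Expand the squared norm of `z = d + w` and bound the mixed term by Cauchy-Schwarz. The form with
-- a difference fits the determinant condition.
∣∣-triangle : ∀ z w → ∣ z ∣ ≤ ∣ z -ᶜ w ∣ + ∣ w ∣
∣∣-triangle z w = square-cancel-≤ (+-nonNeg (∣∣-nonNeg d) (∣∣-nonNeg w)) (begin
  ∣ z ∣ * ∣ z ∣                                     ≈⟨ ∣∣*∣∣≈norm² z ⟩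
  norm² z                                           ≈⟨ termwise (λ n → solve 4 (λ a b c d →
    a :* a :+ b :* b :=
    ((a :- c) :* (a :- c) :+ (b :- d) :* (b :- d)) :+ (c :* c :+ d :* d) :+
    (((a :- c) :* c :+ (b :- d) :* d) :+ ((a :- c) :* c :+ (b :- d) :* d))) refl
    (seq (re z) n) (seq (im z) n) (seq (re w) n) (seq (im w) n)) ⟩
  norm² d + norm² w + (dot d w + dot d w)           ≤⟨ +-mono-≤
    (≈⇒≤ (≈-sym (+-cong (∣∣*∣∣≈norm² d) (∣∣*∣∣≈norm² w))))
    (+-mono-≤ (cauchy-schwarz d w) (cauchy-schwarz d w)) ⟩
  ∣ d ∣ * ∣ d ∣ + ∣ w ∣ * ∣ w ∣ + (∣ d ∣ * ∣ w ∣ + ∣ d ∣ * ∣ w ∣)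
    ≈⟨ termwise (λ n → solve 2 (λ x y →
         x :* x :+ y :* y :+ (x :* y :+ x :* y) := (x :+ y) :* (x :+ y)) refl
         (seq (∣ d ∣) n) (seq (∣ w ∣) n)) ⟩
  (∣ d ∣ + ∣ w ∣) * (∣ d ∣ + ∣ w ∣)                 ∎)
  where
  open ≤-Reasoning
  d = z -ᶜ w

determinant⇒∣∣-≤ : ∀ z w z′ w′ → z *ᶜ w -ᶜ z′ *ᶜ w′ ≈ᶜ 1ℂ →
                   ∣ z ∣ * ∣ w ∣ ≤ 1ℝ + ∣ z′ ∣ * ∣ w′ ∣
determinant⇒∣∣-≤ z w z′ w′ det≈1 = begin
  ∣ z ∣ * ∣ w ∣                                     ≈⟨ ∣∣-* z w ⟨
  ∣ z *ᶜ w ∣                                        ≤⟨ ∣∣-triangle (z *ᶜ w) (z′ *ᶜ w′) ⟩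
  ∣ z *ᶜ w -ᶜ z′ *ᶜ w′ ∣ + ∣ z′ *ᶜ w′ ∣             ≈⟨ +-cong
    (≈-trans (∣∣-cong det≈1) ∣1∣≈1) (∣∣-* z′ w′) ⟩
  1ℝ + ∣ z′ ∣ * ∣ w′ ∣                              ∎
  where open ≤-Reasoning

-- Telescoping along two adjacent rows

0<1 : 0ℝ < 1ℝ
0<1 = mk< 1ℚ (ℚ.positive⁻¹ 1ℚ) (0 , λ _ _ → ℚ.≤-refl)

-- Divided by `β * β′`, the recursion says that `α / β` is at most `1 / (β * β′) + α′ / β′`, hence
-- at most `t + s` with `t` the reciprocal of `m * m′`. Two separate lower bounds are kept because
-- at either end of the row one of them is 1 and the other `M`.
ratio-step : ∀ {α β α′ β′ m m′ s t} → 0ℝ < m → 0ℝ < m′ → m ≤ β → m′ ≤ β′ →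
             0ℝ ≤ t → (m * m′) * t ≈ 1ℝ →
             α * β′ ≤ 1ℝ + α′ * β → α′ ≤ β′ * s → α ≤ β * (s + t)
ratio-step {α} {β} {α′} {β′} {m} {m′} {s} {t} 0<m 0<m′ m≤β m′≤β′ 0≤t mm′t≈1 αβ′≤ α′≤β′s =
  *-cancelʳ-≤ (<-≤-trans 0<m′ m′≤β′) (begin
    α * β′                        ≤⟨ αβ′≤ ⟩
    1ℝ + α′ * β                   ≈⟨ +-cong mm′t≈1 ≈-refl ⟨
    m * m′ * t + α′ * β           ≤⟨ +-mono-≤
      (*-monoˡ-≤ 0≤t (*-mono-≤ (<⇒≤ 0<m′) 0≤β m≤β m′≤β′)) (*-monoˡ-≤ 0≤β α′≤β′s) ⟩
    β * β′ * t + β′ * s * β       ≈⟨ termwise (λ n → solve 4 (λ b c s t →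
      b :* c :* t :+ c :* s :* b := b :* (s :+ t) :* c) refl
      (seq β n) (seq β′ n) (seq s n) (seq t n)) ⟩
    β * (s + t) * β′              ∎)
  where
  open ≤-Reasoning
  0≤β = ≤-trans (<⇒≤ 0<m) m≤β

-- Entry k of α and β stands for |a_{i+2+k}| and |b_{i+2+k}|, and the height is suc n.
row-bound : ∀ {M} (0<M : 0ℝ < M) n (α β : ℕ → ℝ) →
  (∀ k → k ℕ.≤ suc n → α k * β (suc k) ≤ 1ℝ + α (suc k) * β k) →
  (∀ k → 1 ℕ.≤ k → k ℕ.≤ suc n → M ≤ β k) →
  β 0 ≈ 1ℝ → β (2 ℕ.+ n) ≈ 1ℝ → α (2 ℕ.+ n) ≈ 0ℝ →
  α 0 ≤ (fromℕ n + fromℕ 2 * M) / (M * M) [ *-pos 0<M 0<M ]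
row-bound {M} 0<M n α β rec M≤β β₀≈1 βₗ≈1 αₗ≈0 = begin
  α 0                                                ≤⟨ first ⟩
  β 0 * ((M + fromℕ n) * v + M * v)                  ≈⟨ *-cong β₀≈1 ≈-refl ⟩
  1ℝ * ((M + fromℕ n) * v + M * v)                   ≈⟨ termwise (λ k → solve 3 (λ m n v →
    con 1ℚ :* ((m :+ n) :* v :+ m :* v) := (n :+ (con 1ℚ :+ con 1ℚ) :* m) :* v) refl
    (seq M k) (seq (fromℕ n) k) (seq v k)) ⟩
  (fromℕ n + fromℕ 2 * M) * v                        ∎
  where
  open ≤-Reasoning
  0<MM = *-pos 0<M 0<M
  v = inverse (M * M) 0<MM
  0≤v = inverse-nonNeg (M * M) 0<MM
  0≤Mv = *-nonNeg (<⇒≤ 0<M) 0≤v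
  MMv≈1 = *-inverseʳ (M * M) 0<MM

  -- The reciprocal of `M` is written `M * v`, so the single inverse `v` of `M * M` serves all terms
  -- of the sum.
  M1Mv≈1 : M * 1ℝ * (M * v) ≈ 1ℝ
  M1Mv≈1 = ≈-trans (termwise λ n → solve 2 (λ m v → m :* con 1ℚ :* (m :* v) := m :* m :* v) refl
                     (seq M n) (seq v n)) MMv≈1

  1MMv≈1 : 1ℝ * M * (M * v) ≈ 1ℝ
  1MMv≈1 = ≈-trans (termwise λ n → solve 2 (λ m v → con 1ℚ :* m :* (m :* v) := m :* m :* v) refl
                     (seq M n) (seq v n)) MMv≈1

  -- Induction on the distance `k` from column `m` to the last interior column `suc n`: the final
  -- step contributes `M * v`, each of the `k` steps before it contributes `v`.
  bound : ∀ k m → 1 ℕ.≤ m → m ℕ.+ k ≡ suc n → α m ≤ β m * ((M + fromℕ k) * v)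
  bound zero m 1≤m m+0≡1+n with ≡.trans (≡.sym (ℕ.+-identityʳ m)) m+0≡1+n
  ... | refl = begin
    -- The neighbouring entry of `β` is the border 1, so `m′` is 1; that of `α` is the border 0, so
    -- the sum starts from 0.
    α (suc n)                              ≤⟨ ratio-step 0<M 0<1 (M≤β (suc n) 1≤m ℕ.≤-refl)
      (≈⇒≤ (≈-sym βₗ≈1)) 0≤Mv M1Mv≈1 (rec (suc n) ℕ.≤-refl)
      (≈⇒≤ (≈-trans αₗ≈0 (termwise λ j → ≡.sym (ℚ.*-zeroʳ (seq (β (2 ℕ.+ n)) j))))) ⟩
    β (suc n) * (0ℝ + M * v)               ≈⟨ termwise (λ j → solve 3 (λ b m v →
      b :* (con 0ℚ :+ m :* v) := b :* ((m :+ con 0ℚ) :* v)) refl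
      (seq (β (suc n)) j) (seq M j) (seq v j)) ⟩
    β (suc n) * ((M + fromℕ 0) * v)        ∎
  bound (suc k) m 1≤m m+1+k≡1+n = begin
    α m                                    ≤⟨ ratio-step 0<M 0<M (M≤β m 1≤m m≤1+n)
      (M≤β (suc m) (ℕ.s≤s ℕ.z≤n) 1+m≤1+n) 0≤v MMv≈1 (rec m m≤1+n)
      (bound k (suc m) (ℕ.s≤s ℕ.z≤n) 1+m+k≡1+n) ⟩
    β m * ((M + fromℕ k) * v + v)          ≈⟨ termwise (λ j → solve 4 (λ b m k v →
      b :* ((m :+ k) :* v :+ v) := b :* ((m :+ (k :+ con 1ℚ)) :* v)) refl
      (seq (β m) j) (seq M j) (seq (fromℕ k) j) (seq v j)) ⟩
    β m * ((M + (fromℕ k + 1ℝ)) * v)       ≈⟨ *-cong ≈-refl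
      (*-cong (+-cong ≈-refl (fromℕ-suc k)) ≈-refl) ⟨
    β m * ((M + fromℕ (suc k)) * v)        ∎
    where
    1+m+k≡1+n : suc m ℕ.+ k ≡ suc n
    1+m+k≡1+n = ≡.trans (≡.sym (ℕ.+-suc m k)) m+1+k≡1+n
    1+m≤1+n : suc m ℕ.≤ suc n
    1+m≤1+n = subst (suc m ℕ.≤_) 1+m+k≡1+n (ℕ.m≤m+n (suc m) k)
    m≤1+n : m ℕ.≤ suc n
    m≤1+n = ℕ.≤-trans (ℕ.n≤1+n m) 1+m≤1+n

  -- Column 0 is separate: there `β` is the border 1 instead of an entry bounded below by `M`, which
  -- gives the second extreme term `M * v`.
  first : α 0 ≤ β 0 * ((M + fromℕ n) * v + M * v)
  first = ratio-step 0<1 0<M (≈⇒≤ (≈-sym β₀≈1)) (M≤β 1 ℕ.≤-refl (ℕ.s≤s ℕ.z≤n)) 0≤Mv 1MMv≈1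
    (rec 0 ℕ.z≤n) (bound n 1 ℕ.≤-refl refl)

-- Specialisation to the moduli of two adjacent rows of a frieze

theorem3p6 : ∀ {ℓ : Level} (R : Pred ℂ ℓ) → R Respects _≈ᶜ_ →
    ∀ (M : ℝ) → IsInfimum (absoluteValues (R ∖0)) M → (0<M : 0ℝ < M) →
    ∀ (n : ℕ) → .{{NonZero n}} → ∀ (c : ℤ → ℤ → ℂ) → IsFriezePattern (R ∖0) n c →
    ∀ (i : ℤ) →
    ∣ quiddity c i ∣ ≤ ((fromℕ n - 1ℝ) + fromℕ 2 * M) / (M * M) [ *-pos 0<M 0<M ]
theorem3p6 R _ M (M≤ , _) 0<M (suc n) c frieze i = begin
  ∣ quiddity c i ∣
    ≤⟨ row-bound 0<M n α β rec M≤β β₀≈1 βₗ≈1 αₗ≈0 ⟩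
  (fromℕ n + fromℕ 2 * M) * v
    ≈⟨ *-cong (+-cong n≈ ≈-refl) ≈-refl ⟩
  ((fromℕ (suc n) - 1ℝ) + fromℕ 2 * M) * v ∎
  where
  open ≤-Reasoning
  open IsFriezePattern frieze
  v = inverse (M * M) (*-pos 0<M 0<M)

  n≈ : fromℕ n ≈ fromℕ (suc n) - 1ℝ
  n≈ = ≈-trans (termwise λ j → solve 1 (λ x → x := x :+ con 1ℚ :- con 1ℚ) refl (seq (fromℕ n) j))
               (+-cong (≈-sym (fromℕ-suc n)) ≈-refl)

  1+i : ℤ
  1+i = ℤ.suc i

  -- The second row starts one column later, so offsets `2 + k` and `1 + k` name the same column;
  -- `α 0` is the modulus of the quiddity entry by computation.
  α β : ℕ → ℝ
  α k = ∣ c i (i ℤ.+ + (2 ℕ.+ k)) ∣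
  β k = ∣ c 1+i (1+i ℤ.+ + (1 ℕ.+ k)) ∣

  shift : ∀ k → 1+i ℤ.+ + k ≡ i ℤ.+ + suc k
  shift k = ≡.trans (cong (ℤ._+ + k) (ℤ.+-comm (+ 1) i)) (ℤ.+-assoc i (+ 1) (+ k))

  suc-+ : ∀ k → ℤ.suc (i ℤ.+ + k) ≡ i ℤ.+ + suc k
  suc-+ k = ≡.trans (≡.sym (ℤ.+-assoc (+ 1) i (+ k))) (shift k)

  +-mono : ∀ j {k l} → k ℕ.≤ l → j ℤ.+ + k ℤ.≤ j ℤ.+ + l
  +-mono j k≤l = ℤ.+-monoʳ-≤ j (ℤ.+≤+ k≤l)

  inRange : ∀ j k → k ℕ.≤ suc n ℕ.+ 3 → InRange (suc n) j (j ℤ.+ + k)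
  inRange j k k≤ = ℤ.i≤i+j j (+ k) , +-mono j k≤

  rec : ∀ k → k ℕ.≤ suc n → α k * β (suc k) ≤ 1ℝ + α (suc k) * β k
  rec k k≤1+n = determinant⇒∣∣-≤
    (c i (i ℤ.+ + (2 ℕ.+ k))) (c 1+i (1+i ℤ.+ + (2 ℕ.+ k)))
    (c i (i ℤ.+ + (3 ℕ.+ k))) (c 1+i (1+i ℤ.+ + (1 ℕ.+ k)))
    (det (suc-+ (2 ℕ.+ k)) (≡.trans (suc-+ (2 ℕ.+ k)) (≡.sym (shift (2 ℕ.+ k)))) (≡.sym (shift (1 ℕ.+ k))))
    where
    -- For `k` equal to `suc n` this reaches the zero border of row `i`, the last column in range.
    3+k≤ : 3 ℕ.+ k ℕ.≤ suc n ℕ.+ 3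
    3+k≤ = subst (3 ℕ.+ k ℕ.≤_) (ℕ.+-comm 3 (suc n)) (ℕ.+-monoʳ-≤ 3 k≤1+n)
    2+k≤ = ℕ.≤-trans (ℕ.n≤1+n (2 ℕ.+ k)) 3+k≤
    1+k≤ = ℕ.≤-trans (ℕ.n≤1+n (1 ℕ.+ k)) 2+k≤
    -- The column indices are variables tied by equations, so that matching on `refl` rewrites all
    -- three at once inside the determinant.
    det : ∀ {l m j} → ℤ.suc (i ℤ.+ + (2 ℕ.+ k)) ≡ l → ℤ.suc (i ℤ.+ + (2 ℕ.+ k)) ≡ m →
          i ℤ.+ + (2 ℕ.+ k) ≡ j →
          c i (i ℤ.+ + (2 ℕ.+ k)) *ᶜ c 1+i m -ᶜ c i l *ᶜ c 1+i j ≈ᶜ 1ℂ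
    det refl refl refl = determinant i (i ℤ.+ + (2 ℕ.+ k))
      (inRange i (2 ℕ.+ k) 2+k≤)
      (subst (InRange (suc n) 1+i) (≡.trans (shift (2 ℕ.+ k)) (≡.sym (suc-+ (2 ℕ.+ k))))
        (inRange 1+i (2 ℕ.+ k) 2+k≤))
      (subst (InRange (suc n) i) (≡.sym (suc-+ (2 ℕ.+ k))) (inRange i (3 ℕ.+ k) 3+k≤))
      (subst (InRange (suc n) 1+i) (shift (1 ℕ.+ k)) (inRange 1+i (1 ℕ.+ k) 1+k≤))

  M≤β : ∀ k → 1 ℕ.≤ k → k ℕ.≤ suc n → M ≤ β k
  -- Offsets `1 + k` then run from 2 to `n + 2`, which is exactly the interior of a pattern of
  -- height `suc n`.
  M≤β k 1≤k k≤1+n = M≤ (β k) (_ , entry 1+i (1+i ℤ.+ + (1 ℕ.+ k)) (+-mono 1+i (ℕ.s≤s 1≤k))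
    (+-mono 1+i (subst (suc k ℕ.≤_) (ℕ.+-comm 1 (suc n)) (ℕ.s≤s k≤1+n))) , ≈-refl)

  β₀≈1 : β 0 ≈ 1ℝ
  β₀≈1 = ≈-trans (∣∣-cong (left-one 1+i)) ∣1∣≈1

  βₗ≈1 : β (2 ℕ.+ n) ≈ 1ℝ
  βₗ≈1 = ≈-trans (∣∣-cong (subst (λ k → c 1+i (1+i ℤ.+ + k) ≈ᶜ 1ℂ)
    (ℕ.+-comm (suc n) 2) (right-one 1+i))) ∣1∣≈1

  αₗ≈0 : α (2 ℕ.+ n) ≈ 0ℝ
  αₗ≈0 = ≈-trans (∣∣-cong (subst (λ k → c i (i ℤ.+ + k) ≈ᶜ 0ℂ)
    (ℕ.+-comm (suc n) 3) (right-zero i))) ∣0∣≈0
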